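{- Let $G$ be a $2$-edge-connected graph and $e\in E(G)$. Then the inequality $x_e\ge 0$ defines a facet of $\mathrm{TECSP}(G)$ if and only if $e$ is not contained in any cut of size exactly $3$.
   Context: All graphs are finite, simple and undirected. For $\emptyset\subsetneq S\subsetneq V(G)$, $\delta(S)$ is the set of edges with exactly one endpoint in $S$ (a cut); a cut with $k$ edges is a $k$-cut. An edge $e$ is a bridge if $\{e\}=\delta(S)$ for some $S$. A graph is $2$-edge-connected if it is connected and has no bridges; the empty graph and a single vertex are $2$-edge-connected. $\chi^H\in\{0,1\}^{E(G)}$ is the incidence vector of $E(H)$, and $\mathrm{TECSP}(G)=\mathrm{conv}\{\chi^H : H\subseteq G\text{ is }2\text{ -edge-connected}\}\subseteq\mathbb{R}^{E(G)}$. A facet is a face of dimension $\dim(\mathrm{TECSP}(G))-1$. -}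

module Defs where

open import Level using (_⊔_) renaming (suc to lsuc)
open import Algebra.Apartness.Bundles using (HeytingField; HeytingCommutativeRing)
open import Algebra.Bundles using (CommutativeRing)
import Algebra.Properties.CommutativeMonoid.Sum as CMSum
open import Data.Bool.Base using (if_then_else_; _∧_; _xor_)
open import Data.Fin.Base as Fin using (Fin)
open import Data.Fin.Subset using (Subset; ⊤; ⁅_⁆; _∈_; _⊂_; Nonempty)
open import Data.Fin.Subset.Properties using (∈⊤)
open import Data.Integer.Base as ℤ using (ℤ; +_; 1ℤ)
open import Data.Nat.Base using (ℕ; suc)
open import Data.Product.Base using (∃; ∃-syntax; _×_; _,_; proj₁; proj₂)
open import Data.Sum.Base using (_⊎_)
open import Data.Vec.Base using (lookup; tabulate)
open import Data.Vec.Functional using (Vector)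
open import Function.Bundles using (_⇔_)
open import Function.Definitions using (Injective)
open import Relation.Binary.Core using (Rel)
open import Relation.Binary.Structures using (IsStrictPartialOrder)
open import Relation.Binary.Construct.Closure.ReflexiveTransitive using (Star)
open import Relation.Binary.PropositionalEquality.Core using (_≡_)
open import Relation.Nullary.Negation.Core using (¬_)
open import Relation.Unary using (Pred)

------------------------------------------------------------------------
-- Scalars

-- agda-stdlib has no real numbers; ordered fields stand in for them.
-- Classically these are exactly the (linearly) ordered fields, since
-- then _#_ is the negation of _≈_ and #⇔<> is trichotomy.  With _#_
-- kept as a primitive, the constructive reals are also an instance.
record OrderedField c ℓ₁ ℓ₂ ℓ₃ : Set (lsuc (c ⊔ ℓ₁ ⊔ ℓ₂ ⊔ ℓ₃)) where
  infix 4 _<_ _≤_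
  field
    heytingField : HeytingField c ℓ₁ ℓ₂
  open HeytingField heytingField public
  open HeytingCommutativeRing heytingCommutativeRing public
    using (commutativeRing)
  field
    _<_                    : Rel Carrier ℓ₃
    <-isStrictPartialOrder : IsStrictPartialOrder _≈_ _<_
    #⇔<>                   : ∀ x y → (x # y) ⇔ (x < y ⊎ y < x)
    +-monoˡ-<              : ∀ z {x y} → x < y → x + z < y + z
    *-pos                  : ∀ {x y} → 0# < x → 0# < y → 0# < x * y

  _≤_ : Rel Carrier ℓ₃
  x ≤ y = ¬ (y < x)

------------------------------------------------------------------------
-- Graphs

-- A finite simple graph with V(G) = Fin n and E(G) = Fin m.  An edge is
-- stored as its pair of endpoints in increasing order, which excludes
-- loops and makes injectivity of `ends` exclude parallel edges.
record Graph : Set where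
  field
    n m     : ℕ
    ends    : Fin m → Fin n × Fin n
    ordered : ∀ e → proj₁ (ends e) Fin.< proj₂ (ends e)
    simple  : Injective _≡_ _≡_ ends

  src tgt : Fin m → Fin n
  src e = proj₁ (ends e)
  tgt e = proj₂ (ends e)

module _ (G : Graph) where
  open Graph G

  record Subgraph : Set where
    field
      VS     : Subset n
      ES     : Subset m
      closed : ∀ {e} → e ∈ ES → src e ∈ VS × tgt e ∈ VS

  whole : Subgraph
  whole = record { VS = ⊤ ; ES = ⊤ ; closed = λ _ → ∈⊤ , ∈⊤ }

module _ {G : Graph} (H : Subgraph G) where
  open Graph G
  open Subgraph H

  Adjacent : Fin n → Fin n → Set
  Adjacent u v = ∃[ e ] (e ∈ ES × (ends e ≡ (u , v) ⊎ ends e ≡ (v , u)))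

  Connected : Set
  Connected = ∀ {u v} → u ∈ VS → v ∈ VS → Star Adjacent u v

  δ : Subset n → Subset m
  δ S = tabulate λ e →
    lookup ES e ∧ (lookup S (src e) xor lookup S (tgt e))

  IsCut : Subset m → Set
  IsCut D = ∃[ S ] (Nonempty S × S ⊂ VS × D ≡ δ S)

  IsBridge : Fin m → Set
  IsBridge e = IsCut ⁅ e ⁆

  -- The empty graph and a single vertex qualify.
  TwoEdgeConnected : Set
  TwoEdgeConnected = Connected × (∀ e → ¬ IsBridge e)

------------------------------------------------------------------------
-- Polyhedra

module Polyhedra {c ℓ₁ ℓ₂ ℓ₃} (𝔽 : OrderedField c ℓ₁ ℓ₂ ℓ₃) where
  open OrderedField 𝔽
  open CMSum (CommutativeRing.+-commutativeMonoid commutativeRing) using (sum)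

  Point : ℕ → Set c
  Point m = Vector Carrier m

  infix 8 _·_
  _·_ : ∀ {m} → Point m → Point m → Carrier
  a · x = sum λ j → a j * x j

  χ : ∀ {m} → Subset m → Point m
  χ D j = if lookup D j then 1# else 0#

  combination : ∀ {k m} → Vector Carrier k → Vector (Point m) k → Point m
  combination w p j = sum λ i → w i * p i j

  conv : ∀ {m ℓ} → Pred (Point m) ℓ → Pred (Point m) (c ⊔ ℓ₁ ⊔ ℓ₃ ⊔ ℓ)
  conv {m} X x = ∃[ k ] ∃[ w ] ∃ λ (p : Vector (Point m) k) →
    (∀ i → X (p i)) × (∀ i → 0# ≤ w i) × sum w ≈ 1# ×
    (∀ j → x j ≈ combination w p j)

  AffinelyIndependent : ∀ {k m} → Vector (Point m) k → Set (c ⊔ ℓ₁)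
  AffinelyIndependent p =
    ∀ w → sum w ≈ 0# → (∀ j → combination w p j ≈ 0#) → ∀ i → w i ≈ 0#

  -- The maximal number of affinely independent points, minus one; in
  -- particular the empty set has dimension -1.
  HasDim : ∀ {m ℓ} → Pred (Point m) ℓ → ℤ → Set (c ⊔ ℓ₁ ⊔ ℓ)
  HasDim {m} P d = ∃[ k ] (
    d ≡ + k ℤ.- 1ℤ ×
    (∃ λ (p : Vector (Point m) k) → (∀ i → P (p i)) × AffinelyIndependent p) ×
    (∀ (p : Vector (Point m) (suc k)) → (∀ i → P (p i)) → ¬ AffinelyIndependent p))

  -- The inequality a · x ≥ b is valid for P, and the face of P that it
  -- defines is a facet.
  DefinesFacet : ∀ {m ℓ} → Pred (Point m) ℓ → Point m → Carrier →
                 Set (c ⊔ ℓ₁ ⊔ ℓ₃ ⊔ ℓ)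
  DefinesFacet P a b =
    (∀ x → P x → b ≤ a · x) ×
    ∃[ d ] (HasDim P d × HasDim (λ x → P x × a · x ≈ b) (d ℤ.- 1ℤ))

  TECSP : (G : Graph) → Pred (Point (Graph.m G)) (c ⊔ ℓ₁ ⊔ ℓ₃)
  TECSP G = conv λ x → ∃ λ (H : Subgraph G) →
    TwoEdgeConnected H × (∀ j → x j ≈ χ (Subgraph.ES H) j)

{-# OPTIONS --safe #-}
module Submission where

-- Write f ~ g if {f} Δ {g} lies in the GF(2)-span of the cuts, i.e. if f = g or {f , g} is a 2-cut.
-- All points of TECSP(G) agree on the coordinates of a class of ~, so its dimension is at most the
-- number of classes.  Conversely, deleting the class [f] leaves a bridgeless graph, so the
-- components of G and of G ∖ [f] are 2-edge-connected, and their incidence vectors differ by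
-- χ([f]); hence the dimension is the number of classes.  If e lies in no 3-cut, then G ∖ [e] ∖ [f] is
-- bridgeless too, and the same argument in G ∖ [e] gives one dimension less.  If {e , f , g} is a cut,
-- then x_f = x_g on the face, whereas x_e and x_f − x_g are both nonzero on TECSP(G) and even
-- independent there, so the face has codimension at least two.

open import Defs
open import Algebra.Bundles using (CommutativeMonoid; CommutativeRing)
import Algebra.Apartness.Properties.HeytingCommutativeRing as HeytingProperties
import Algebra.Properties.CommutativeSemigroup as CommSemigroup
import Algebra.Properties.Ring as RingProperties
import Algebra.Properties.Semiring.Sum as SemiringSum
open import Data.Bool.Base using (Bool; true; false; not; _∧_; _xor_; if_then_else_)
open import Data.Bool.Properties using (xor-∧-commutativeRing; xor-same; xor-comm;
  xor-identityʳ; ∧-conicalˡ; ∧-conicalʳ)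
  renaming (_≟_ to _≟ᵇ_)
open import Data.Fin.Base using (Fin; zero; suc; punchIn; _↑ˡ_; _↑ʳ_)
open import Data.Fin.Properties using (_≟_; all?; splitAt-↑ˡ; splitAt-↑ʳ; punchInᵢ≢i)
  renaming (any? to anyFin?)
open import Data.Fin.Subset using (Subset; ⊤; ⊥; ⁅_⁆; _∈_; _∉_; ∣_∣; _∩_; _-_; _⊂_; Nonempty; Empty)
open import Data.Fin.Subset.Properties using (∈⊤; ∉⊥; x∈⁅x⁆; x∈⁅y⁆⇒x≡y; x≢y⇒x∉⁅y⁆; ⊆-antisym;
  anySubset?; x∈p∩q⁺; x∈p∩q⁻; _∈?_; x∈p∧x≢y⇒x∈p-y; p─⊥≡p; p─q⊆p; Empty-unique; ∣⊥∣≡0; nonempty?)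
open import Data.Integer.Base as ℤ using (+_; 1ℤ)
open import Data.List.Base using (List; []; _∷_; allFin)
open import Data.List.Membership.DecPropositional using () renaming (_∈?_ to ∈ˡ-dec)
open import Data.List.Membership.Propositional using (find; lose) renaming (_∈_ to _∈ˡ_)
open import Data.List.Membership.Propositional.Properties using (∈-allFin)
open import Data.List.Relation.Unary.Any using (Any; here; there; any?)
open import Data.Nat.Base as ℕ using (ℕ; zero; suc)
open import Data.Nat.Properties using (suc-injective)
open import Data.Product.Base using (∃; ∃-syntax; _×_; _,_; proj₁; proj₂)
open import Data.Sum.Base using (_⊎_; inj₁; inj₂) renaming (swap to ⊎-swap; map₂ to ⊎-map₂)
open import Data.Vec.Base using (lookup; tabulate; zipWith; []; _∷_; _[_]=_)
open import Data.Vec.Functional using (Vector; concat; insertAt) renaming (_∷_ to _∷ᶠ_)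
open import Data.Vec.Functional.Properties using (insertAt-lookup; insertAt-punchIn)
open import Data.Vec.Properties using (lookup∘tabulate; lookup-zipWith; lookup-replicate; []=⇒lookup; lookup⇒[]=)
open import Function.Base using (_∘_; id; case_of_)
open import Function.Bundles using (_⇔_; mk⇔; Equivalence)
open import Relation.Binary.Construct.Closure.ReflexiveTransitive using (Star; ε; _◅_; _◅◅_; reverse)
open import Relation.Binary.PropositionalEquality
open import Relation.Binary.Structures using (IsStrictPartialOrder)
open import Relation.Nullary.Decidable using (Dec; yes; no; does; dec-true; dec-false)
open import Relation.Nullary.Negation using (¬_; contradiction)
open import Relation.Unary using (Pred)

-- Booleans and cardinalities of finite subsets.

does⇒ : ∀ {a} {A : Set a} (A? : Dec A) → does A? ≡ true → A
does⇒ (yes a) _ = a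

open CommSemigroup
  (CommutativeMonoid.commutativeSemigroup (CommutativeRing.+-commutativeMonoid xor-∧-commutativeRing))
  using () renaming (interchange to xor-interchange)

∣p∣≡1+∣p-x∣ : ∀ {n} {x : Fin n} {p} → x ∈ p → ∣ p ∣ ≡ suc ∣ p - x ∣
∣p∣≡1+∣p-x∣ {x = zero}  {true ∷ p}  x∈p = cong (suc ∘ ∣_∣) (sym (p─⊥≡p p))
∣p∣≡1+∣p-x∣ {x = suc x} {true ∷ p}  (_[_]=_.there x∈p) = cong suc (∣p∣≡1+∣p-x∣ x∈p)
∣p∣≡1+∣p-x∣ {x = suc x} {false ∷ p} (_[_]=_.there x∈p) = ∣p∣≡1+∣p-x∣ x∈p

x∉p-x : ∀ {n} {x : Fin n} {p} → x ∉ p - x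
x∉p-x {x = zero}  {s ∷ p} ()
x∉p-x {x = suc x} {s ∷ p} (_[_]=_.there x∈) = x∉p-x {x = x} x∈

∣p∣≡1+k⇒Nonempty : ∀ {n k} {p : Subset n} → ∣ p ∣ ≡ suc k → Nonempty p
∣p∣≡1+k⇒Nonempty {n} {p = p} eq with nonempty? p
... | yes ne = ne
... | no ¬ne = contradiction (trans (sym eq) (trans (cong ∣_∣ (Empty-unique ¬ne)) (∣⊥∣≡0 n))) λ ()

-- The cut space of a graph over GF(2).

module CutSpace (G : Graph) where
  open Graph G
  open Subgraph

  -- The cut vector of `S` over GF(2). Since `S` may also be empty or full, these vectors form a
  -- linear space.
  cross : Subset n → Fin m → Bool
  cross S t = lookup S (src t) xor lookup S (tgt t)

  ∈-δ⁺ : ∀ (H : Subgraph G) S {t} → t ∈ ES H → cross S t ≡ true → t ∈ δ H S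
  ∈-δ⁺ H S {t} t∈H t∈S = lookup⇒[]= t _
    (trans (lookup∘tabulate _ t) (cong₂ _∧_ ([]=⇒lookup t∈H) t∈S))

  ∈-δ⁻ : ∀ (H : Subgraph G) S {t} → t ∈ δ H S → t ∈ ES H × cross S t ≡ true
  ∈-δ⁻ H S {t} t∈δ = lookup⇒[]= t _ (∧-conicalˡ _ _ eq) , ∧-conicalʳ _ _ eq
    where eq = trans (sym (lookup∘tabulate _ t)) ([]=⇒lookup t∈δ)

  cut-proper : ∀ S {t} → cross S t ≡ true → ∀ {VS} → src t ∈ VS → tgt t ∈ VS →
               Nonempty (S ∩ VS) × (S ∩ VS) ⊂ VS
  cut-proper S {t} t∈S {VS} src∈ tgt∈ with lookup S (src t) in s | lookup S (tgt t) in t'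
  ... | true  | false = (_ , x∈p∩q⁺ (lookup⇒[]= _ S s , src∈)) ,
    (proj₂ ∘ x∈p∩q⁻ S VS) , _ , tgt∈ , λ t∈ → contradiction
      (trans (sym ([]=⇒lookup (proj₁ (x∈p∩q⁻ S VS t∈)))) t') λ ()
  ... | false | true  = (_ , x∈p∩q⁺ (lookup⇒[]= _ S t' , tgt∈)) ,
    (proj₂ ∘ x∈p∩q⁻ S VS) , _ , src∈ , λ t∈ → contradiction
      (trans (sym ([]=⇒lookup (proj₁ (x∈p∩q⁻ S VS t∈)))) s) λ ()

  cross-∩ : ∀ S {VS t} → src t ∈ VS → tgt t ∈ VS → cross (S ∩ VS) t ≡ cross S t
  cross-∩ S {VS} {t} src∈ tgt∈ = cong₂ _xor_ (restrict src∈) (restrict tgt∈)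
    where
    restrict : ∀ {u} → u ∈ VS → lookup (S ∩ VS) u ≡ lookup S u
    restrict {u} u∈ rewrite lookup-zipWith _∧_ u S VS | []=⇒lookup u∈ with lookup S u
    ... | true  = refl
    ... | false = refl

  IsCut-δ : ∀ (H : Subgraph G) S {t} → t ∈ ES H → cross S t ≡ true → IsCut H (δ H (S ∩ VS H))
  IsCut-δ H S t∈H t∈S with cut-proper S t∈S (proj₁ (closed H t∈H)) (proj₂ (closed H t∈H))
  ... | ne , prop = _ , ne , prop , refl

  -- If `h` were the only edge of `H` crossing `S`, the cut of `H` at `S ∩ VS H` would make `h` a
  -- bridge. This form of bridgelessness lets `S` range over all vertex sets of G.
  not-crossed-once : ∀ {H : Subgraph G} → TwoEdgeConnected H → ∀ S {h} → h ∈ ES H →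
    cross S h ≡ true → ¬ (∀ t → t ∈ ES H → cross S t ≡ true → t ≡ h)
  not-crossed-once {H} (_ , bridgeless) S {h} h∈H h∈S only =
    bridgeless h (subst (IsCut H) (⊆-antisym to from) (IsCut-δ H S h∈H h∈S))
    where
    S∩ = λ {t} (t∈H : t ∈ ES H) → cross-∩ S {VS H} {t} (proj₁ (closed H t∈H)) (proj₂ (closed H t∈H))
    to : ∀ {t} → t ∈ δ H (S ∩ VS H) → t ∈ ⁅ h ⁆
    to t∈δ with ∈-δ⁻ H (S ∩ VS H) t∈δ
    ... | t∈H , t∈S = subst (_∈ ⁅ h ⁆) (sym (only _ t∈H (trans (sym (S∩ t∈H)) t∈S))) (x∈⁅x⁆ h)
    from : ∀ {t} → t ∈ ⁅ h ⁆ → t ∈ δ H (S ∩ VS H)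
    from t∈h with refl ← x∈⁅y⁆⇒x≡y h t∈h = ∈-δ⁺ H (S ∩ VS H) h∈H (trans (S∩ h∈H) h∈S)

  -- Coparallel edges.

  infix 4 _~_ _~?_
  -- Cut vectors are closed under addition, so a single `S` describes any member of their span. The
  -- right-hand side is {f} Δ {g}, the zero vector when `f ≡ g`.
  _~_ : Fin m → Fin m → Set
  f ~ g = ∃[ S ] ∀ t → cross S t ≡ does (t ≟ f) xor does (t ≟ g)

  abstract
    _~?_ : ∀ f g → Dec (f ~ g)
    f ~? g = anySubset? λ S → all? λ t → _ ≟ᵇ _

  -- The map from vertex sets to cut vectors is linear over GF(2), with symmetric difference as
  -- addition.
  cross-⊕ : ∀ S S′ t → cross (zipWith _xor_ S S′) t ≡ cross S t xor cross S′ t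
  cross-⊕ S S′ t
    rewrite lookup-zipWith _xor_ (src t) S S′ | lookup-zipWith _xor_ (tgt t) S S′ =
    xor-interchange (lookup S (src t)) _ _ _

  ~-refl : ∀ {f} → f ~ f
  ~-refl {f} = ⊤ , λ t → trans (xor-⊤ t) (sym (xor-same (does (t ≟ f))))
    where
    xor-⊤ : ∀ t → cross ⊤ t ≡ false
    xor-⊤ t rewrite lookup-replicate (src t) true | lookup-replicate (tgt t) true = refl

  ~-sym : ∀ {f g} → f ~ g → g ~ f
  ~-sym {f} {g} (S , eq) = S , λ t → trans (eq t) (xor-comm (does (t ≟ f)) _)

  ~-intro : ∀ {f g} S → f ≢ g → cross S f ≡ true → cross S g ≡ true →
            (∀ t → cross S t ≡ true → t ≡ f ⊎ t ≡ g) → f ~ g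
  ~-intro {f} {g} S f≢g f∈S g∈S only = S , eq
    where
    eq : ∀ t → cross S t ≡ does (t ≟ f) xor does (t ≟ g)
    eq t with t ≟ f | t ≟ g
    ... | yes refl | yes refl = contradiction refl f≢g
    ... | yes refl | no _     = f∈S
    ... | no _     | yes refl = g∈S
    ... | no t≢f   | no t≢g   with cross S t in t∈S
    ...   | false = refl
    ...   | true  with only t t∈S
    ...     | inj₁ t≡f = contradiction t≡f t≢f
    ...     | inj₂ t≡g = contradiction t≡g t≢g

  -- If `H` contained `f` but not `g`, the cut {f , g} would meet `H` in `f` alone, and `f` would be
  -- a bridge of `H`.
  ~⇒⊆ : ∀ {H : Subgraph G} → TwoEdgeConnected H → ∀ {f g} → f ~ g → f ∈ ES H → g ∈ ES H
  ~⇒⊆ {H} 2ec {f} {g} (S , eq) f∈H with g ∈? ES H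
  ... | yes g∈H = g∈H
  ... | no  g∉H = contradiction only (not-crossed-once {H} 2ec S f∈H f∈S)
    where
    f≢g : f ≢ g
    f≢g refl = g∉H f∈H
    f∈S : cross S f ≡ true
    f∈S rewrite eq f | dec-true (f ≟ f) refl | dec-false (f ≟ g) f≢g = refl
    only : ∀ t → t ∈ ES H → cross S t ≡ true → t ≡ f
    only t t∈H t∈S with t ≟ f | t ≟ g | eq t
    ... | yes t≡f | _        | _ = t≡f
    ... | no _    | yes refl | _ = contradiction t∈H g∉H
    ... | no _    | no _     | e = contradiction (trans (sym t∈S) e) λ ()

  -- Connected components

  Adj : (Fin m → Bool) → Fin n → Fin n → Set
  Adj A u v = ∃[ t ] (A t ≡ true × (ends t ≡ (u , v) ⊎ ends t ≡ (v , u)))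

  Adj-sym : ∀ {A u v} → Adj A u v → Adj A v u
  Adj-sym (t , t∈A , inj₁ e) = t , t∈A , inj₂ e
  Adj-sym (t , t∈A , inj₂ e) = t , t∈A , inj₁ e

  module Components (A : Fin m → Bool) where

    -- Every vertex starts with its own label, and each edge of `A` in the list merges the labels of
    -- its endpoints.
    label-edges : (T : List (Fin m)) → ∃ λ (ℓ : Fin n → Fin n) →
      (∀ u v → ℓ u ≡ ℓ v → Star (Adj A) u v) ×
      (∀ {t} → t ∈ˡ T → A t ≡ true → ℓ (src t) ≡ ℓ (tgt t))
    label-edges [] = id , (λ { u .u refl → ε }) , λ ()
    label-edges (t₀ ∷ T) with label-edges T | A t₀ in t₀∈A
    ... | ℓ , joined , constant | false = ℓ , joined , λ
      { (here refl) t∈A → contradiction (trans (sym t∈A) t₀∈A) λ ()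
      ; (there t∈T) t∈A → constant t∈T t∈A }
    ... | ℓ , joined , constant | true = merge ∘ ℓ , joined′ , constant′
      where
      a = ℓ (src t₀)
      b = ℓ (tgt t₀)
      merge : Fin n → Fin n
      merge l = if does (l ≟ a) then b else l
      step : ∀ u v → ℓ u ≡ a → ℓ v ≡ b → Star (Adj A) u v
      step u v u~a v~b = joined u _ u~a ◅◅ (t₀ , t₀∈A , inj₁ refl) ◅ joined _ v (sym v~b)
      joined′ : ∀ u v → merge (ℓ u) ≡ merge (ℓ v) → Star (Adj A) u v
      joined′ u v eq with ℓ u ≟ a | ℓ v ≟ a
      ... | yes u~a | yes v~a = joined u v (trans u~a (sym v~a))
      ... | yes u~a | no _    = step u v u~a (sym eq)
      ... | no _    | yes v~a = reverse Adj-sym (step v u v~a eq)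
      ... | no _    | no _    = joined u v eq
      constant′ : ∀ {t} → t ∈ˡ t₀ ∷ T → A t ≡ true → merge (ℓ (src t)) ≡ merge (ℓ (tgt t))
      constant′ (there t∈T) t∈A = cong merge (constant t∈T t∈A)
      constant′ (here refl) _ with a ≟ a | b ≟ a
      ... | yes _  | yes _ = refl
      ... | yes _  | no _  = refl
      ... | no a≢a | _     = contradiction refl a≢a

    label : Fin n → Fin n
    label = proj₁ (label-edges (allFin m))

    label-joined : ∀ u v → label u ≡ label v → Star (Adj A) u v
    label-joined = proj₁ (proj₂ (label-edges (allFin m)))

    label-constant : ∀ t → A t ≡ true → label (src t) ≡ label (tgt t)
    label-constant t = proj₂ (proj₂ (label-edges (allFin m))) (∈-allFin t)

    -- A label that no vertex carries gives the empty subgraph, which counts as 2-edge-connected;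
    -- hence all of `Fin n` can serve as index set.
    component : Fin n → Subgraph G
    component v = record
      { VS = tabulate λ u → does (label u ≟ v)
      ; ES = tabulate λ t → A t ∧ does (label (src t) ≟ v)
      ; closed = λ {t} t∈ →
          let eq = trans (sym (lookup∘tabulate _ t)) ([]=⇒lookup t∈)
              src≡v = does⇒ (_ ≟ v) (∧-conicalʳ _ _ eq)
          in vertex src≡v , vertex (trans (sym (label-constant t (∧-conicalˡ _ _ eq))) src≡v)
      }
      where
      vertex : ∀ {u} → label u ≡ v → u ∈ tabulate λ u → does (label u ≟ v)
      vertex {u} eq = lookup⇒[]= u _ (trans (lookup∘tabulate _ u) (dec-true (_ ≟ v) eq))

    ∈-component⁻ : ∀ {u v} → u ∈ VS (component v) → label u ≡ v
    ∈-component⁻ {u} {v} u∈ = does⇒ (_ ≟ v) (trans (sym (lookup∘tabulate _ u)) ([]=⇒lookup u∈))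

    ∈-component-edge : ∀ {t v} → A t ≡ true → label (src t) ≡ v → t ∈ ES (component v)
    ∈-component-edge {t} {v} t∈A eq = lookup⇒[]= t _
      (trans (lookup∘tabulate _ t) (cong₂ _∧_ t∈A (dec-true (_ ≟ v) eq)))

    ∈-component-edge⁻ : ∀ {t v} → t ∈ ES (component v) → A t ≡ true × label (src t) ≡ v
    ∈-component-edge⁻ {t} {v} t∈ = ∧-conicalˡ _ _ eq , does⇒ (_ ≟ v) (∧-conicalʳ _ _ eq)
      where eq = trans (sym (lookup∘tabulate _ t)) ([]=⇒lookup t∈)

    component-connected : ∀ v → Connected (component v)
    component-connected v {u₁} {u₂} u₁∈ u₂∈ =
      lift (label-joined u₁ u₂ (trans (∈-component⁻ u₁∈) (sym (∈-component⁻ u₂∈)))) (∈-component⁻ u₁∈)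
      where
      -- Edges of `A` preserve labels, so the path never leaves the component.
      lift : ∀ {u w} → Star (Adj A) u w → label u ≡ v → Star (Adjacent (component v)) u w
      lift ε _ = ε
      lift ((t , t∈A , inj₁ refl) ◅ p) u∈ =
        (t , ∈-component-edge t∈A u∈ , inj₁ refl) ◅ lift p (trans (sym (label-constant t t∈A)) u∈)
      lift ((t , t∈A , inj₂ refl) ◅ p) u∈ =
        let src≡v = trans (label-constant t t∈A) u∈
        in (t , ∈-component-edge t∈A src≡v , inj₂ refl) ◅ lift p src≡v

    Bridgeless : Set
    Bridgeless = ∀ S h → A h ≡ true → cross S h ≡ true →
      ¬ (∀ t → A t ≡ true → cross S t ≡ true → t ≡ h)

    -- An edge of `A` with an endpoint in the component lies in it entirely. A bridge of the
    -- component, cut off by `S`, is therefore the only edge of `A` crossing `S` in G.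
    component-2ec : Bridgeless → ∀ v → TwoEdgeConnected (component v)
    component-2ec bridgeless v = component-connected v , no-bridge
      where
      no-bridge : ∀ h → ¬ IsBridge (component v) h
      no-bridge h (S , _ , (S⊆VS , _) , h≡δ) =
        bridgeless S h (proj₁ (∈-component-edge⁻ (proj₁ h∈))) (proj₂ h∈) only
        where
        h∈ = ∈-δ⁻ (component v) S (subst (h ∈_) h≡δ (x∈⁅x⁆ h))
        endpoint : ∀ t → A t ≡ true → cross S t ≡ true → label (src t) ≡ v
        endpoint t t∈A t∈S with lookup S (src t) in s | lookup S (tgt t) in s′
        ... | true  | _    = ∈-component⁻ (S⊆VS (lookup⇒[]= _ S s))
        ... | false | true = trans (label-constant t t∈A) (∈-component⁻ (S⊆VS (lookup⇒[]= _ S s′)))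
        only : ∀ t → A t ≡ true → cross S t ≡ true → t ≡ h
        only t t∈A t∈S = x∈⁅y⁆⇒x≡y h (subst (t ∈_) (sym h≡δ)
          (∈-δ⁺ (component v) S (∈-component-edge t∈A (endpoint t t∈A t∈S)) t∈S))

  open Components public

  -- Removing coparallel classes

  parallel? : (L : List (Fin m)) → ∀ t → Dec (Any (t ~_) L)
  parallel? L t = any? (t ~?_) L

  avoiding : List (Fin m) → Fin m → Bool
  avoiding L t = not (does (parallel? L t))

  -- Adding vectors {t , l} of the cut space moves all crossing edges in the classes of L into L.
  concentrate : ∀ L S (T : List (Fin m)) → ∃[ S′ ]
    (∀ t → ¬ Any (t ~_) L → cross S′ t ≡ cross S t) ×
    (∀ {t} → t ∈ˡ T → Any (t ~_) L → cross S′ t ≡ true → t ∈ˡ L)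
  concentrate L S [] = S , (λ _ _ → refl) , λ ()
  concentrate L S (t₀ ∷ T) with concentrate L S T
  ... | S′ , same , moved with parallel? L t₀ | ∈ˡ-dec _≟_ t₀ L | cross S′ t₀ in t₀∈S′
  ...   | no ¬p | _ | _ = S′ , same , λ
          { (here refl) p _ → contradiction p ¬p ; (there t∈T) → moved t∈T }
  ...   | yes _ | yes t₀∈L | _ = S′ , same , λ
          { (here refl) _ _ → t₀∈L ; (there t∈T) → moved t∈T }
  ...   | yes _ | no _ | false = S′ , same , λ
          { (here refl) _ t∈S′ → contradiction (trans (sym t∈S′) t₀∈S′) λ () ; (there t∈T) → moved t∈T }
  ...   | yes p | no t₀∉L | true with find p
  ...     | l , l∈L , S₀ , eq = zipWith _xor_ S′ S₀ , same′ , moved′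
    where
    cross-new : ∀ t → cross (zipWith _xor_ S′ S₀) t ≡ cross S′ t xor (does (t ≟ t₀) xor does (t ≟ l))
    cross-new t = trans (cross-⊕ S′ S₀ t) (cong (cross S′ t xor_) (eq t))
    same′ : ∀ t → ¬ Any (t ~_) L → cross (zipWith _xor_ S′ S₀) t ≡ cross S t
    same′ t ¬p rewrite cross-new t with t ≟ t₀ | t ≟ l
    ... | yes refl | _        = contradiction p ¬p
    ... | no _     | yes refl = contradiction (lose l∈L ~-refl) ¬p
    ... | no _     | no _     = trans (xor-identityʳ _) (same t ¬p)
    moved′ : ∀ {t} → t ∈ˡ t₀ ∷ T → Any (t ~_) L → cross (zipWith _xor_ S′ S₀) t ≡ true → t ∈ˡ L
    moved′ {t} t∈ q rewrite cross-new t with t ≟ l | t ≟ t₀ | t∈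
    ... | yes refl | _        | _           = λ _ → l∈L
    ... | no t≢l   | yes refl | _ rewrite t₀∈S′ = λ ()
    ... | no _     | no t≢t₀  | here t≡t₀   = contradiction t≡t₀ t≢t₀
    ... | no _     | no _     | there t∈T   = moved t∈T q ∘ trans (sym (xor-identityʳ _))

  -- No cut consists of one edge outside the classes of `L` and otherwise of members of `L`. Only
  -- the listed edges count, not their whole classes, so for lists of length at most two the
  -- condition concerns cuts of at most three edges.
  Detached : List (Fin m) → Set
  Detached L = ∀ S h → ¬ Any (h ~_) L → cross S h ≡ true →
    ¬ (∀ t → cross S t ≡ true → t ≡ h ⊎ t ∈ˡ L)

  -- If `h` is the only remaining edge across `S`, all other crossing edges lie in the classes of
  -- `L`. `concentrate` pushes them into `L` without affecting `h`, which contradicts `Detached L`.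
  avoiding-bridgeless : ∀ L → Detached L → Bridgeless (avoiding L)
  avoiding-bridgeless L detached S h h∈A h∈S only with concentrate L S (allFin m)
  ... | S′ , same , moved = detached S′ h ¬p (trans (same h ¬p) h∈S) only′
    where
    ¬p : ¬ Any (h ~_) L
    ¬p p = contradiction (trans (sym h∈A) (cong not (dec-true (parallel? L h) p))) λ ()
    only′ : ∀ t → cross S′ t ≡ true → t ≡ h ⊎ t ∈ˡ L
    only′ t t∈S′ = by-cases (parallel? L t)
      where
      by-cases : Dec (Any (t ~_) L) → t ≡ h ⊎ t ∈ˡ L
      by-cases (yes p) = inj₂ (moved (∈-allFin t) p t∈S′)
      by-cases (no ¬q) = inj₁ (only t (cong not (dec-false (parallel? L t) ¬q))
        (trans (sym (same t ¬q)) t∈S′))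

  -- Graphs without bridges

  ThreeCut : Fin m → Set
  ThreeCut e = ∃[ D ] (IsCut (whole G) D × ∣ D ∣ ≡ 3 × e ∈ D)

  three-cut⁺ : ∀ S {e f g} → e ≢ f → e ≢ g → f ≢ g →
    cross S e ≡ true → cross S f ≡ true → cross S g ≡ true →
    (∀ t → cross S t ≡ true → t ≡ e ⊎ t ≡ f ⊎ t ≡ g) → ThreeCut e
  three-cut⁺ S {e} {f} {g} e≢f e≢g f≢g e∈S f∈S g∈S only =
    D , IsCut-δ (whole G) S ∈⊤ e∈S , size , ∈D e∈S
    where
    D = δ (whole G) (S ∩ ⊤)
    ∈D : ∀ {t} → cross S t ≡ true → t ∈ D
    ∈D {t} t∈S = ∈-δ⁺ (whole G) (S ∩ ⊤) ∈⊤ (trans (cross-∩ S {⊤} {t} ∈⊤ ∈⊤) t∈S)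
    D-e-f-g-empty : Empty (D - e - f - g)
    D-e-f-g-empty (t , t∈) with only t (trans (sym (cross-∩ S {⊤} {t} ∈⊤ ∈⊤))
        (proj₂ (∈-δ⁻ (whole G) (S ∩ ⊤) (p─q⊆p D _ (p─q⊆p (D - e) _ (p─q⊆p (D - e - f) _ t∈))))))
    ... | inj₁ refl        = x∉p-x {p = D} (p─q⊆p (D - e) _ (p─q⊆p (D - e - f) _ t∈))
    ... | inj₂ (inj₁ refl) = x∉p-x {p = D - e} (p─q⊆p (D - e - f) _ t∈)
    ... | inj₂ (inj₂ refl) = x∉p-x {p = D - e - f} t∈
    size : ∣ D ∣ ≡ 3
    size = begin
      ∣ D ∣                        ≡⟨ ∣p∣≡1+∣p-x∣ (∈D e∈S) ⟩
      1 ℕ.+ ∣ D - e ∣              ≡⟨ cong suc (∣p∣≡1+∣p-x∣ f∈) ⟩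
      2 ℕ.+ ∣ D - e - f ∣          ≡⟨ cong (2 ℕ.+_) (∣p∣≡1+∣p-x∣ g∈) ⟩
      3 ℕ.+ ∣ D - e - f - g ∣      ≡⟨ cong (λ p → 3 ℕ.+ ∣ p ∣) (Empty-unique D-e-f-g-empty) ⟩
      3 ℕ.+ ∣ ⊥ {m} ∣              ≡⟨ cong (3 ℕ.+_) (∣⊥∣≡0 m) ⟩
      3                            ∎
      where
      open ≡-Reasoning
      f∈ = x∈p∧x≢y⇒x∈p-y (∈D f∈S) (≢-sym e≢f)
      g∈ = x∈p∧x≢y⇒x∈p-y (x∈p∧x≢y⇒x∈p-y (∈D g∈S) (≢-sym e≢g)) (≢-sym f≢g)

  three-cut⁻ : ∀ {e} → ThreeCut e → ∃[ S ] ∃[ f ] ∃[ g ] (e ≢ f × e ≢ g × f ≢ g ×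
    cross S e ≡ true × cross S f ≡ true × cross S g ≡ true ×
    (∀ t → cross S t ≡ true → t ≡ e ⊎ t ≡ f ⊎ t ≡ g))
  three-cut⁻ {e} (D , (S , _ , _ , refl) , ∣D∣≡3 , e∈D)
    with ∣D-e∣≡2 ← suc-injective (trans (sym (∣p∣≡1+∣p-x∣ e∈D)) ∣D∣≡3)
    with f , f∈ ← ∣p∣≡1+k⇒Nonempty ∣D-e∣≡2
    with ∣D-e-f∣≡1 ← suc-injective (trans (sym (∣p∣≡1+∣p-x∣ f∈)) ∣D-e∣≡2)
    with g , g∈ ← ∣p∣≡1+k⇒Nonempty ∣D-e-f∣≡1
    with ∣D-e-f-g∣≡0 ← suc-injective (trans (sym (∣p∣≡1+∣p-x∣ g∈)) ∣D-e-f∣≡1) =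
    S , f , g ,
    (λ { refl → x∉p-x {p = D} f∈ }) ,
    (λ { refl → x∉p-x {p = D} (p─q⊆p (D - e) _ g∈) }) ,
    (λ { refl → x∉p-x {p = D - e} g∈ }) ,
    crosses e∈D , crosses (p─q⊆p D _ f∈) , crosses (p─q⊆p D _ (p─q⊆p (D - e) _ g∈)) , only
    where
    crosses : ∀ {t} → t ∈ D → cross S t ≡ true
    crosses = proj₂ ∘ ∈-δ⁻ (whole G) S
    only : ∀ t → cross S t ≡ true → t ≡ e ⊎ t ≡ f ⊎ t ≡ g
    only t t∈S with t ≟ e | t ≟ f | t ≟ g
    ... | yes t≡e | _       | _       = inj₁ t≡e
    ... | no _    | yes t≡f | _       = inj₂ (inj₁ t≡f)
    ... | no _    | no _    | yes t≡g = inj₂ (inj₂ t≡g)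
    -- A fourth crossing edge would survive the removal of `e`, `f` and `g`, which leaves nothing.
    ... | no t≢e  | no t≢f  | no t≢g  = contradiction
      (trans (sym (∣p∣≡1+∣p-x∣ (x∈p∧x≢y⇒x∈p-y (x∈p∧x≢y⇒x∈p-y (x∈p∧x≢y⇒x∈p-y
        (∈-δ⁺ (whole G) S ∈⊤ t∈S) t≢e) t≢f) t≢g))) ∣D-e-f-g∣≡0) λ ()

  -- A transversal of the classes other than that of `e`, found greedily. Alone it serves the face,
  -- and together with `e` the whole polytope.
  representatives : ∀ e → ∃[ c ] ∃ λ (r : Fin c → Fin m) →
    (∀ i j → r i ~ r j → i ≡ j) × (∀ i → ¬ r i ~ e) × (∀ t → t ~ e ⊎ ∃[ i ] t ~ r i)
  representatives e = let c , r , inj , ≁e , cover = go (allFin m)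
    in c , r , inj , ≁e , λ t → cover (∈-allFin t)
    where
    go : (T : List (Fin m)) → ∃[ c ] ∃ λ (r : Fin c → Fin m) →
      (∀ i j → r i ~ r j → i ≡ j) × (∀ i → ¬ r i ~ e) × (∀ {t} → t ∈ˡ T → t ~ e ⊎ ∃[ i ] t ~ r i)
    go [] = 0 , (λ ()) , (λ ()) , (λ ()) , λ ()
    go (t₀ ∷ T) with c , r , inj , ≁e , cover ← go T with t₀ ~? e | anyFin? (λ i → t₀ ~? r i)
    ... | yes t₀~e | _ = c , r , inj , ≁e , λ { (here refl) → inj₁ t₀~e ; (there t∈T) → cover t∈T }
    ... | no _ | yes found = c , r , inj , ≁e , λ { (here refl) → inj₂ found ; (there t∈T) → cover t∈T }
    ... | no t₀≁e | no new = suc c , (t₀ ∷ᶠ r) , inj′ , ≁e′ , cover′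
      where
      inj′ : ∀ i j → (t₀ ∷ᶠ r) i ~ (t₀ ∷ᶠ r) j → i ≡ j
      inj′ zero    zero    _ = refl
      inj′ zero    (suc j) p = contradiction (j , p) new
      inj′ (suc i) zero    p = contradiction (i , ~-sym p) new
      inj′ (suc i) (suc j) p = cong suc (inj i j p)
      ≁e′ : ∀ i → ¬ (t₀ ∷ᶠ r) i ~ e
      ≁e′ zero    = t₀≁e
      ≁e′ (suc i) = ≁e i
      cover′ : ∀ {t} → t ∈ˡ t₀ ∷ T → t ~ e ⊎ ∃[ i ] t ~ (t₀ ∷ᶠ r) i
      cover′ (here refl) = inj₂ (zero , ~-refl)
      cover′ (there t∈T) with cover t∈T
      ... | inj₁ t~e       = inj₁ t~e
      ... | inj₂ (i , t~r) = inj₂ (suc i , t~r)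

  -- Small cuts of a 2-edge-connected graph.

  module TwoEdgeConnectedGraph (2ec : TwoEdgeConnected (whole G)) where

    no-bridge : ∀ S h → cross S h ≡ true → ¬ (∀ t → cross S t ≡ true → t ≡ h)
    no-bridge S h h∈S only = not-crossed-once {whole G} 2ec S ∈⊤ h∈S (λ t _ → only t)

    detached-[] : Detached []
    detached-[] S h _ h∈S only = no-bridge S h h∈S λ t t∈S → case only t t∈S of λ
      { (inj₁ t≡h) → t≡h }

    -- A cut inside {h , e} through `h` is either {h , e}, giving `h ~ e`, or the bridge `h`.
    detached-[_] : ∀ e → Detached (e ∷ [])
    detached-[ e ] S h h≁ h∈S only with cross S e in e∈S
    ... | true  = h≁ (here (~-intro S (λ { refl → h≁ (here ~-refl) }) h∈S e∈S λ t t∈S →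
                    case only t t∈S of λ { (inj₁ t≡h) → inj₁ t≡h ; (inj₂ (here t≡e)) → inj₂ t≡e }))
    ... | false = no-bridge S h h∈S λ t t∈S → case only t t∈S of λ
                    { (inj₁ t≡h) → t≡h
                    ; (inj₂ (here refl)) → contradiction (trans (sym t∈S) e∈S) λ () }

    -- A cut inside {h , e , f} through `h` that contains both `e` and `f` is a 3-cut through `e`;
    -- this is where the absence of 3-cuts enters. Otherwise one of `e` and `f` drops out and
    -- `detached-[_]` applies.
    detached-pair : ∀ {e f} → ¬ ThreeCut e → ¬ f ~ e → Detached (f ∷ e ∷ [])
    detached-pair {e} {f} no-cut f≁e S h h≁ h∈S only with cross S e in e∈S | cross S f in f∈S
    ... | true | true = no-cut (three-cut⁺ S (λ { refl → f≁e ~-refl })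
            (λ { refl → h≁ (there (here ~-refl)) }) (λ { refl → h≁ (here ~-refl) }) e∈S f∈S h∈S
            λ t t∈S → case only t t∈S of λ
              { (inj₁ t≡h) → inj₂ (inj₂ t≡h)
              ; (inj₂ (here t≡f)) → inj₂ (inj₁ t≡f)
              ; (inj₂ (there (here t≡e))) → inj₁ t≡e })
    ... | true | false = detached-[ e ] S h (λ { (here h~e) → h≁ (there (here h~e)) }) h∈S λ t t∈S →
            case only t t∈S of λ
              { (inj₁ t≡h) → inj₁ t≡h
              ; (inj₂ (here refl)) → contradiction (trans (sym t∈S) f∈S) λ ()
              ; (inj₂ (there (here t≡e))) → inj₂ (here t≡e) }
    ... | false | _ = detached-[ f ] S h (λ { (here h~f) → h≁ (here h~f) }) h∈S λ t t∈S →
            case only t t∈S of λ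
              { (inj₁ t≡h) → inj₁ t≡h
              ; (inj₂ (here t≡f)) → inj₂ (here t≡f)
              ; (inj₂ (there (here refl))) → contradiction (trans (sym t∈S) e∈S) λ () }

    avoiding-yes : ∀ L {t} → ¬ Any (t ~_) L → avoiding L t ≡ true
    avoiding-yes L {t} ¬p = cong not (dec-false (parallel? L t) ¬p)

    avoiding-no : ∀ L {t} → Any (t ~_) L → avoiding L t ≡ false
    avoiding-no L {t} p = cong not (dec-true (parallel? L t) p)

    -- The component of `f` after deletion of the class of `g`. It shows that x_f - x_g is not
    -- constantly zero on the polytope.
    separate : ∀ {f g} → ¬ f ~ g → ∃[ H ] (TwoEdgeConnected H × f ∈ ES H × g ∉ ES H)
    separate {f} {g} f≁g = component A v , component-2ec A bridgeless v ,
      ∈-component-edge A f∈A refl , λ g∈ → contradiction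
        (trans (sym (proj₁ (∈-component-edge⁻ A g∈))) (avoiding-no (g ∷ []) (here ~-refl))) λ ()
      where
      A = avoiding (g ∷ [])
      bridgeless = avoiding-bridgeless (g ∷ []) detached-[ g ]
      v = label A (src f)
      f∈A : A f ≡ true
      f∈A = avoiding-yes (g ∷ []) λ { (here p) → f≁g p }

    -- For a 3-cut {e , f , g}, a subgraph without `e` that contained just one of `f` and `g` would
    -- have that edge as a bridge.
    three-cut-pair : ∀ {e} → ThreeCut e → ∃[ f ] ∃[ g ] (¬ f ~ g ×
      ∀ {H : Subgraph G} → TwoEdgeConnected H → e ∉ ES H → f ∈ ES H ⇔ g ∈ ES H)
    three-cut-pair {e} cut
      with S , f , g , e≢f , e≢g , f≢g , e∈S , f∈S , g∈S , only ← three-cut⁻ cut =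
      f , g , f≁g , λ {H} 2ecH e∉H → mk⇔
        (transfer {H} 2ecH e∉H f∈S λ t t∈S → ⊎-map₂ ⊎-swap (only t t∈S))
        (transfer {H} 2ecH e∉H g∈S only)
      where
      transfer : ∀ {H : Subgraph G} → TwoEdgeConnected H → e ∉ ES H → ∀ {f g} → cross S f ≡ true →
        (∀ t → cross S t ≡ true → t ≡ e ⊎ t ≡ g ⊎ t ≡ f) → f ∈ ES H → g ∈ ES H
      transfer {H} 2ecH e∉H {f} {g} f∈S only f∈H with g ∈? ES H
      ... | yes g∈H = g∈H
      ... | no g∉H  = contradiction (λ t t∈H t∈S → case only t t∈S of λ
        { (inj₁ refl)        → contradiction t∈H e∉H
        ; (inj₂ (inj₁ refl)) → contradiction t∈H g∉H
        ; (inj₂ (inj₂ t≡f))  → t≡f }) (not-crossed-once {H} 2ecH S f∈H f∈S)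
      f≁g : ¬ f ~ g
      -- Adding the vector {f , g} to the cut {e , f , g} leaves the bridge `e`.
      f≁g (S′ , eq) = no-bridge (zipWith _xor_ S S′) e (trans (crossing e)
        (subst₂ (λ a b → cross S e xor (a xor b) ≡ true) (sym (dec-false (e ≟ f) e≢f))
          (sym (dec-false (e ≟ g) e≢g)) (trans (xor-identityʳ _) e∈S))) only′
        where
        crossing : ∀ t → cross (zipWith _xor_ S S′) t ≡ cross S t xor (does (t ≟ f) xor does (t ≟ g))
        crossing t = trans (cross-⊕ S S′ t) (cong (cross S t xor_) (eq t))
        only′ : ∀ t → cross (zipWith _xor_ S S′) t ≡ true → t ≡ e
        only′ t rewrite crossing t with t ≟ f | t ≟ g
        ... | yes refl | yes refl = contradiction refl f≢g
        ... | yes refl | no _     rewrite f∈S = λ ()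
        ... | no _     | yes refl rewrite g∈S = λ ()
        ... | no t≢f   | no t≢g   = λ t∈ → case only t (trans (sym (xor-identityʳ _)) t∈) of λ
          { (inj₁ t≡e)        → t≡e
          ; (inj₂ (inj₁ t≡f)) → contradiction t≡f t≢f
          ; (inj₂ (inj₂ t≡g)) → contradiction t≡g t≢g }

-- Ordered fields, linear dependence and convex hulls.

module OrderedFieldProperties {c ℓ₁ ℓ₂ ℓ₃} (𝔽 : OrderedField c ℓ₁ ℓ₂ ℓ₃) where
  open OrderedField 𝔽 hiding (zero; refl; sym; trans)
  open OrderedField 𝔽 using () renaming (refl to ≈-refl; sym to ≈-sym; trans to ≈-trans)
  open IsStrictPartialOrder <-isStrictPartialOrder using (<-respˡ-≈; <-respʳ-≈)
    renaming (trans to <-trans; irrefl to <-irrefl)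
  open RingProperties (CommutativeRing.ring commutativeRing)
  open SemiringSum (CommutativeRing.semiring commutativeRing) 
  open HeytingProperties heytingCommutativeRing using (1#0; x-0≈x)
  open import Relation.Binary.Reasoning.Setoid (CommutativeRing.setoid commutativeRing)
  open Polyhedra 𝔽

  -- Order

  -- Tightness of apartness gives this case split under double negation, which suffices for negated
  -- goals such as `_≤_` and linear dependence.
  ¬¬-≈0⊎#0 : ∀ x → ¬ ¬ (x ≈ 0# ⊎ x # 0#)
  ¬¬-≈0⊎#0 x k = k (inj₁ (proj₁ (tight x 0#) (k ∘ inj₂)))

  ≤∧#⇒< : ∀ {x} → 0# ≤ x → x # 0# → 0# < x
  ≤∧#⇒< 0≤x x#0 with Equivalence.to (#⇔<> _ _) x#0
  ... | inj₁ x<0 = contradiction x<0 0≤x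
  ... | inj₂ 0<x = 0<x

  ≤-respʳ-≈ : ∀ {x y} → x ≈ y → 0# ≤ x → 0# ≤ y
  ≤-respʳ-≈ x≈y 0≤x y<0 = 0≤x (<-respˡ-≈ (≈-sym x≈y) y<0)

  y<x+y : ∀ {x y} → 0# < x → y < x + y
  y<x+y {x} {y} 0<x = <-respˡ-≈ (+-identityˡ y) (+-monoˡ-< y 0<x)

  +-nonneg : ∀ {x y} → 0# ≤ x → 0# ≤ y → 0# ≤ x + y
  +-nonneg {x} {y} 0≤x 0≤y x+y<0 = ¬¬-≈0⊎#0 x λ
    { (inj₁ x≈0) → 0≤y (<-respˡ-≈ (≈-trans (+-congʳ x≈0) (+-identityˡ y)) x+y<0)
    ; (inj₂ x#0) → 0≤y (<-trans (y<x+y (≤∧#⇒< 0≤x x#0)) x+y<0) }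

  sum-nonneg : ∀ {k} {f : Vector Carrier k} → (∀ i → 0# ≤ f i) → 0# ≤ sum f
  sum-nonneg {zero}  0≤f = <-irrefl ≈-refl
  sum-nonneg {suc k} 0≤f = +-nonneg (0≤f zero) (sum-nonneg (0≤f ∘ suc))

  +-nonneg-≈0 : ∀ {x y} → 0# ≤ x → 0# ≤ y → x + y ≈ 0# → x ≈ 0#
  +-nonneg-≈0 0≤x 0≤y x+y≈0 = proj₁ (tight _ _) λ x#0 →
    0≤y (<-respʳ-≈ x+y≈0 (y<x+y (≤∧#⇒< 0≤x x#0)))

  sum-nonneg-≈0 : ∀ {k} {f : Vector Carrier k} → (∀ i → 0# ≤ f i) → sum f ≈ 0# → ∀ i → f i ≈ 0#
  sum-nonneg-≈0 0≤f eq zero = +-nonneg-≈0 (0≤f zero) (sum-nonneg (0≤f ∘ suc)) eq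
  sum-nonneg-≈0 0≤f eq (suc i) = sum-nonneg-≈0 (0≤f ∘ suc)
    (+-nonneg-≈0 (sum-nonneg (0≤f ∘ suc)) (0≤f zero) (≈-trans (+-comm _ _) eq)) i

  0<-x : ∀ {x} → x < 0# → 0# < - x
  0<-x {x} x<0 = <-respˡ-≈ (-‿inverseʳ x) (<-respʳ-≈ (+-identityˡ (- x)) (+-monoˡ-< (- x) x<0))

  0<1 : 0# < 1#
  0<1 = case Equivalence.to (#⇔<> _ _) 1#0 of λ
    -- If 1 < 0, then 1 = (-1)(-1) is a product of positive elements.
    { (inj₁ 1<0) → <-respʳ-≈ (≈-trans (-1*x≈-x (- 1#)) (-‿involutive 1#)) (*-pos (0<-x 1<0) (0<-x 1<0))
    ; (inj₂ 0<1) → 0<1 }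

  inverse : ∀ {x} → x # 0# → ∃[ y ] x * y ≈ 1#
  inverse {x} x#0 with y , _ , eq ← #⇒invertible x#0 =
    y , ≈-trans (*-congʳ (≈-sym (x-0≈x x))) eq

  inverse-nonneg : ∀ {x y} → 0# < x → x * y ≈ 1# → 0# ≤ y
  inverse-nonneg {x} {y} 0<x xy≈1 y<0 = <-irrefl ≈-refl (<-trans 0<1
    (<-respʳ-≈ (≈-trans (+-congʳ x[-y]≈-1) (-‿inverseˡ 1#)) (y<x+y (*-pos 0<x (0<-x y<0)))))
    where
    x[-y]≈-1 : x * - y ≈ - 1#
    x[-y]≈-1 = ≈-trans (≈-sym (-‿distribʳ-* x y)) (-‿cong xy≈1)

  *-cancelˡ-≈0 : ∀ {x y z} → x * y ≈ 1# → x * z ≈ 0# → z ≈ 0#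
  *-cancelˡ-≈0 {x} {y} {z} xy≈1 xz≈0 = begin
    z            ≈⟨ *-identityˡ z ⟨
    1# * z       ≈⟨ *-congʳ (≈-trans (*-comm y x) xy≈1) ⟨
    y * x * z    ≈⟨ *-assoc y x z ⟩
    y * (x * z)  ≈⟨ *-congˡ xz≈0 ⟩
    y * 0#       ≈⟨ zeroʳ y ⟩
    0#           ∎

  -- An ordered field has characteristic zero; thus the number of points in an average is
  -- invertible.
  0<sum-1 : ∀ k → 0# < sum {suc k} (λ _ → 1#)
  0<sum-1 zero    = <-respʳ-≈ (≈-sym (+-identityʳ 1#)) 0<1
  0<sum-1 (suc k) = <-trans (0<sum-1 k) (y<x+y 0<1)

  -- Sums

  sum-zero : ∀ {k} {f : Vector Carrier k} → (∀ i → f i ≈ 0#) → sum f ≈ 0#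
  sum-zero {k} f≈0 = ≈-trans (sum-cong-≋ f≈0) (sum-replicate-zero k)

  sum-single : ∀ {k} {f : Vector Carrier k} i → (∀ j → j ≢ i → f j ≈ 0#) → sum f ≈ f i
  sum-single {suc k} {f} i zeros = begin
    sum f                        ≈⟨ sum-remove {i = i} f ⟩
    f i + sum (f ∘ punchIn i)    ≈⟨ +-congˡ (sum-zero λ j → zeros _ (punchInᵢ≢i i j)) ⟩
    f i + 0#                     ≈⟨ +-identityʳ (f i) ⟩
    f i                          ∎

  sum-++ : ∀ j {k} (f : Vector Carrier (j ℕ.+ k)) → sum f ≈ sum (f ∘ (_↑ˡ k)) + sum (f ∘ (j ↑ʳ_))
  sum-++ zero    f = ≈-sym (+-identityˡ _)
  sum-++ (suc j) f = ≈-trans (+-congˡ (sum-++ j (f ∘ suc))) (≈-sym (+-assoc _ _ _))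

  sum-concat : ∀ {j k} (f : Vector (Vector Carrier k) j) → sum (concat f) ≈ sum (sum ∘ f)
  sum-concat {zero}      f = ≈-refl
  sum-concat {suc j} {k} f = begin
    sum (concat f)  ≈⟨ sum-++ k (concat f) ⟩
    sum (concat f ∘ (_↑ˡ (j ℕ.* k))) + sum (concat f ∘ (k ↑ʳ_))
      ≈⟨ +-cong (sum-cong-≋ λ i → reflexive (left i)) (sum-cong-≋ λ i → reflexive (right i)) ⟩
    sum (f zero) + sum (concat (f ∘ suc))     ≈⟨ +-congˡ (sum-concat (f ∘ suc)) ⟩
    sum (f zero) + sum (sum ∘ f ∘ suc)        ∎
    where
    left : ∀ i → concat f (i ↑ˡ (j ℕ.* k)) ≡ f zero i
    left i rewrite splitAt-↑ˡ k i (j ℕ.* k) = refl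
    right : ∀ i → concat f (k ↑ʳ i) ≡ concat (f ∘ suc) i
    right i rewrite splitAt-↑ʳ k (j ℕ.* k) i = refl

  -- Linear dependence

  LinearlyIndependent : ∀ {k n} → (Fin k → Fin n → Carrier) → Set _
  LinearlyIndependent {k} M = ∀ (w : Vector Carrier k) → (∀ j → sum (λ i → w i * M i j) ≈ 0#) → ∀ i → w i ≈ 0#

  ¬¬-zero-or-pivot : ∀ {k} (f : Vector Carrier k) → ¬ ¬ ((∀ i → f i ≈ 0#) ⊎ ∃[ i ] f i # 0#)
  ¬¬-zero-or-pivot {zero}  f c = c (inj₁ λ ())
  ¬¬-zero-or-pivot {suc k} f c = ¬¬-≈0⊎#0 (f zero) λ
    { (inj₂ pivot) → c (inj₂ (zero , pivot))
    ; (inj₁ f₀≈0)  → ¬¬-zero-or-pivot (f ∘ suc) λ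
      { (inj₂ (i , pivot)) → c (inj₂ (suc i , pivot))
      ; (inj₁ zeros)       → c (inj₁ λ { zero → f₀≈0 ; (suc i) → zeros i }) } }

  -- Gaussian elimination on the first column. If it is zero, it is dropped with one row; otherwise
  -- a pivot row clears it, and pivot row and column are dropped.
  too-many-vectors : ∀ n (M : Fin (suc n) → Fin n → Carrier) → ¬ LinearlyIndependent M
  too-many-vectors zero M indep = <-irrefl ≈-refl (<-respʳ-≈ (indep (λ _ → 1#) (λ ()) zero) 0<1)
  too-many-vectors (suc n) M indep = ¬¬-zero-or-pivot (λ i → M i zero) λ
    { (inj₁ zeros)       → too-many-vectors n (λ i j → M (suc i) (suc j)) (drop-column zeros)
    ; (inj₂ (p , pivot)) → let y , eq = inverse pivot
                           in too-many-vectors n (reduced p y) (eliminate p y eq) }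
    where
    drop-column : (∀ i → M i zero ≈ 0#) → LinearlyIndependent λ i j → M (suc i) (suc j)
    drop-column zeros w eq i = indep (0# ∷ᶠ w) columns (suc i)
      where
      columns : ∀ j → sum (λ i → (0# ∷ᶠ w) i * M i j) ≈ 0#
      columns zero    = sum-zero {f = λ i → (0# ∷ᶠ w) i * M i zero} λ i →
        ≈-trans (*-congˡ (zeros i)) (zeroʳ _)
      columns (suc j) = ≈-trans (+-cong (zeroˡ _) (eq j)) (+-identityˡ 0#)

    factor : ∀ p (y : Carrier) → Fin (suc n) → Carrier
    factor p y i = - (M (punchIn p i) zero * y)

    reduced : ∀ p (y : Carrier) → Fin (suc n) → Fin n → Carrier
    reduced p y i j = M (punchIn p i) (suc j) + factor p y i * M p (suc j)

    eliminate : ∀ p y → M p zero * y ≈ 1# → LinearlyIndependent (reduced p y)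
    eliminate p y pivot w eq i = ≈-trans (reflexive (sym (insertAt-punchIn w p a i)))
      (indep w⁺ columns (punchIn p i))
      where
      -- The pivot row collects the multiples of it contained in the reduced rows, so `w⁺` combines
      -- the rows of `M` as `w` combines the reduced ones.
      a = sum λ i → w i * factor p y i
      w⁺ = insertAt w p a
      column : ∀ j → sum (λ i → w⁺ i * M i j) ≈
                     sum (λ i → w i * (M (punchIn p i) j + factor p y i * M p j))
      column j = begin
        sum (λ i → w⁺ i * M i j)
          ≈⟨ sum-remove {i = p} (λ i → w⁺ i * M i j) ⟩
        w⁺ p * M p j + sum (λ i → w⁺ (punchIn p i) * M (punchIn p i) j)
          ≈⟨ +-cong (*-congʳ (reflexive (insertAt-lookup w p a)))
                    (sum-cong-≋ {suc n} λ i → *-congʳ {M (punchIn p i) j} (reflexive (insertAt-punchIn w p a i))) ⟩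
        a * M p j + sum (λ i → w i * M (punchIn p i) j)
          ≈⟨ +-congʳ (*-distribʳ-sum (M p j) (λ i → w i * factor p y i)) ⟩
        sum (λ i → w i * factor p y i * M p j) + sum (λ i → w i * M (punchIn p i) j)
          ≈⟨ ∑-distrib-+ (λ i → w i * factor p y i * M p j) (λ i → w i * M (punchIn p i) j) ⟨
        sum (λ i → w i * factor p y i * M p j + w i * M (punchIn p i) j)
          ≈⟨ sum-cong-≋ {suc n} (λ i → ≈-trans (+-comm _ _) (≈-trans
               (+-congˡ (*-assoc (w i) (factor p y i) (M p j)))
               (≈-sym (distribˡ (w i) (M (punchIn p i) j) _)))) ⟩
        sum (λ i → w i * (M (punchIn p i) j + factor p y i * M p j)) ∎
      cancels : ∀ i → M (punchIn p i) zero + factor p y i * M p zero ≈ 0#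
      cancels i = begin
        x + - (x * y) * M p zero   ≈⟨ +-congˡ (-‿distribˡ-* (x * y) (M p zero)) ⟨
        x + - (x * y * M p zero)   ≈⟨ +-congˡ (-‿cong (*-assoc x y _)) ⟩
        x + - (x * (y * M p zero)) ≈⟨ +-congˡ (-‿cong (*-congˡ (≈-trans (*-comm y _) pivot))) ⟩
        x + - (x * 1#)             ≈⟨ +-congˡ (-‿cong (*-identityʳ x)) ⟩
        x + - x                    ≈⟨ -‿inverseʳ x ⟩
        0#                         ∎
        where x = M (punchIn p i) zero
      columns : ∀ j → sum (λ i → w⁺ i * M i j) ≈ 0#
      columns zero    = ≈-trans (column zero) (sum-zero {suc n} λ i → ≈-trans (*-congˡ (cancels i)) (zeroʳ (w i)))
      columns (suc j) = ≈-trans (column (suc j)) (eq j)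

  -- Dimensions

  -- An additional coordinate 1 turns affine into linear independence. Since `k` coordinates
  -- determine all others, `k + 2` points become vectors in dimension `k + 1`.
  affinely-dependent : ∀ {k m} (p : Vector (Point m) (suc (suc k))) (q : Fin k → Fin m) →
    (∀ t → (∀ i → p i t ≈ 0#) ⊎ ∃[ l ] ∀ i → p i t ≈ p i (q l)) → ¬ AffinelyIndependent p
  affinely-dependent {k} p q determined indep = too-many-vectors (suc k) M λ w eq →
    indep w (≈-trans (sum-cong-≋ λ i → ≈-sym (*-identityʳ (w i))) (eq zero)) λ t →
      case determined t of λ
        { (inj₁ zeros)    → sum-zero {suc (suc k)} λ i → ≈-trans (*-congˡ (zeros i)) (zeroʳ (w i))
        ; (inj₂ (l , ≈l)) → ≈-trans (sum-cong-≋ {suc (suc k)} λ i → *-congˡ {w i} (≈l i)) (eq (suc l)) }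
    where
    M : Fin (suc (suc k)) → Fin (suc k) → Carrier
    M i zero    = 1#
    M i (suc l) = p i (q l)

  module _ {m ℓ} {X : Pred (Point m) ℓ} where

    conv-coordinates : ∀ {f g} → (∀ y → X y → y f ≈ y g) → ∀ {x} → conv X x → x f ≈ x g
    conv-coordinates {f} {g} same {x} (k , w , p , p∈X , _ , _ , x≈) = begin
      x f                  ≈⟨ x≈ f ⟩
      combination w p f    ≈⟨ sum-cong-≋ (λ i → *-congˡ (same (p i) (p∈X i))) ⟩
      combination w p g    ≈⟨ x≈ g ⟨
      x g                  ∎

    ⊆-conv : ∀ {x} → X x → conv X x
    ⊆-conv {x} x∈X = 1 , (λ _ → 1#) , (λ _ → x) , (λ _ → x∈X) ,
      (λ _ 1<0 → <-irrefl ≈-refl (<-trans 0<1 1<0)) , +-identityʳ 1# ,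
      λ j → ≈-sym (≈-trans (+-identityʳ _) (*-identityˡ (x j)))

    -- The witnesses are the average of x₀ and all the points P i false v, and, for each i, the same
    -- average with P i true in place of P i false, which moves it along the i-th unit vector.
    perturbations : ∀ {k N} (r : Fin k → Fin m) {x₀ : Point m} → X x₀ →
      (P : Fin k → Bool → Vector (Point m) N) → (∀ i b v → X (P i b v)) →
      (∀ i l → sum (λ v → P i true v (r l)) ≈
               sum (λ v → P i false v (r l)) + (if does (l ≟ i) then 1# else 0#)) →
      ∃ λ (p : Vector (Point m) (suc k)) → (∀ i → conv X (p i)) × AffinelyIndependent p
    perturbations {k} {N} r {x₀} x₀∈X P P∈X shift = y , y∈conv , indep
      where
      -- The number `1 + k * N` of averaged points as a field element; its inverse `η` is their
      -- common weight.
      one : Carrier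
      one = sum {suc (k ℕ.* N)} λ _ → 1#
      one⁻¹ : ∃[ η ] one * η ≈ 1#
      one⁻¹ = inverse (Equivalence.from (#⇔<> _ _) (inj₂ (0<sum-1 (k ℕ.* N))))
      η = proj₁ one⁻¹
      -- `Q zero` uses `P i false` in every block, and `Q (suc j)` differs from it in block `j`
      -- only.
      Q : Fin (suc k) → Vector (Point m) (suc (k ℕ.* N))
      Q j = x₀ ∷ᶠ concat λ i → P i (does (suc i ≟ j))
      Q∈X : ∀ j i → X (Q j i)
      Q∈X j zero    = x₀∈X
      Q∈X j (suc i) = P∈X _ _ _
      y : Fin (suc k) → Point m
      y j = combination (λ _ → η) (Q j)
      y∈conv : ∀ j → conv X (y j)
      y∈conv j = _ , (λ _ → η) , Q j , Q∈X j , (λ _ → inverse-nonneg (0<sum-1 (k ℕ.* N)) (proj₂ one⁻¹)) ,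
        (begin
          sum {suc (k ℕ.* N)} (λ _ → η)      ≈⟨ sum-cong-≋ {suc (k ℕ.* N)} (λ _ → *-identityˡ η) ⟨
          sum {suc (k ℕ.* N)} (λ _ → 1# * η) ≈⟨ *-distribʳ-sum {suc (k ℕ.* N)} η (λ _ → 1#) ⟨
          one * η                              ≈⟨ proj₂ one⁻¹ ⟩
          1# ∎) , λ _ → ≈-refl
      base : Fin k → Carrier
      base l = x₀ (r l) + sum λ i → sum λ v → P i false v (r l)
      -- A zero row above the identity matrix: the displacement of each `y j` from `y zero` in the
      -- coordinates `r`, before scaling by `η`.
      D : Fin (suc k) → Fin k → Carrier
      D j l = if does (suc l ≟ j) then 1# else 0#
      shifted : Fin (suc k) → Fin k → Fin k → Carrier
      shifted j l i = if does (suc i ≟ j) then (if does (l ≟ i) then 1# else 0#) else 0#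
      block : ∀ j l i → sum (λ v → P i (does (suc i ≟ j)) v (r l)) ≈
        sum (λ v → P i false v (r l)) + shifted j l i
      block j l i with does (suc i ≟ j)
      ... | true  = shift i l
      ... | false = ≈-sym (+-identityʳ _)
      sum-shifted : ∀ j l → sum (shifted j l) ≈ D j l
      sum-shifted j l = ≈-trans (sum-single l λ i i≢l → reflexive (off i i≢l)) (reflexive on)
        where
        off : ∀ i → i ≢ l → shifted j l i ≡ 0#
        off i i≢l rewrite dec-false (l ≟ i) (≢-sym i≢l) with does (suc i ≟ j)
        ... | true  = refl
        ... | false = refl
        on : shifted j l l ≡ D j l
        on rewrite dec-true (l ≟ l) refl = refl
      y-coordinate : ∀ j l → y j (r l) ≈ η * (base l + D j l)
      y-coordinate j l = begin
        sum (λ i → η * Q j i (r l))   ≈⟨ *-distribˡ-sum η (λ i → Q j i (r l)) ⟨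
        η * (x₀ (r l) + sum (concat λ i v → P i (does (suc i ≟ j)) v (r l)))
          ≈⟨ *-congˡ (+-congˡ (sum-concat λ i v → P i (does (suc i ≟ j)) v (r l))) ⟩
        η * (x₀ (r l) + sum (λ i → sum λ v → P i (does (suc i ≟ j)) v (r l)))
          ≈⟨ *-congˡ (+-congˡ (sum-cong-≋ (block j l))) ⟩
        η * (x₀ (r l) + sum (λ i → sum (λ v → P i false v (r l)) + shifted j l i))
          ≈⟨ *-congˡ (+-congˡ (≈-trans (∑-distrib-+ _ (shifted j l)) (+-congˡ (sum-shifted j l)))) ⟩
        η * (x₀ (r l) + (sum (λ i → sum λ v → P i false v (r l)) + D j l))
          ≈⟨ *-congˡ (+-assoc _ _ _) ⟨
        η * (base l + D j l) ∎
      indep : AffinelyIndependent y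
      indep w Σw≈0 Σwy≈0 = λ { zero → w₀≈0 ; (suc l) → w₊≈0 l }
        where
        D-column : ∀ l → sum (λ j → w j * D j l) ≈ w (suc l)
        D-column l = ≈-trans (sum-single (suc l) off) on
          where
          off : ∀ j → j ≢ suc l → w j * D j l ≈ 0#
          off j j≢ rewrite dec-false (suc l ≟ j) (≢-sym j≢) = zeroʳ (w j)
          on : w (suc l) * D (suc l) l ≈ w (suc l)
          on rewrite dec-true (suc l ≟ suc l) refl = *-identityʳ (w (suc l))
        -- As the weights sum to zero, the common part `base l` cancels and only `η * w (suc l)`
        -- remains of coordinate `r l`.
        w₊≈0 : ∀ l → w (suc l) ≈ 0#
        w₊≈0 l = *-cancelˡ-≈0 {x = η} {y = one} (≈-trans (*-comm η one) (proj₂ one⁻¹)) (begin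
          η * w (suc l)            ≈⟨ *-congˡ (+-identityˡ _) ⟨
          η * (0# + w (suc l))     ≈⟨ *-congˡ (+-cong (≈-trans (*-congʳ Σw≈0) (zeroˡ (base l))) (D-column l)) ⟨
          η * (sum w * base l + sum (λ j → w j * D j l))
            ≈⟨ *-congˡ (+-congʳ (*-distribʳ-sum (base l) w)) ⟩
          η * (sum (λ j → w j * base l) + sum (λ j → w j * D j l))
            ≈⟨ *-congˡ (∑-distrib-+ (λ j → w j * base l) (λ j → w j * D j l)) ⟨
          η * sum (λ j → w j * base l + w j * D j l)
            ≈⟨ *-distribˡ-sum η (λ j → w j * base l + w j * D j l) ⟩
          sum (λ j → η * (w j * base l + w j * D j l))
            ≈⟨ sum-cong-≋ (λ j → rearranged j) ⟩
          sum (λ j → w j * y j (r l))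
            ≈⟨ Σwy≈0 (r l) ⟩
          0# ∎)
          where
          rearranged : ∀ j → η * (w j * base l + w j * D j l) ≈ w j * y j (r l)
          rearranged j = begin
            η * (w j * base l + w j * D j l)   ≈⟨ *-congˡ (distribˡ (w j) _ _) ⟨
            η * (w j * (base l + D j l))       ≈⟨ *-assoc η (w j) _ ⟨
            η * w j * (base l + D j l)         ≈⟨ *-congʳ (*-comm η (w j)) ⟩
            w j * η * (base l + D j l)         ≈⟨ *-assoc (w j) η _ ⟩
            w j * (η * (base l + D j l))       ≈⟨ *-congˡ (y-coordinate j l) ⟨
            w j * y j (r l)                    ∎
        w₀≈0 : w zero ≈ 0#
        w₀≈0 = begin
          w zero                  ≈⟨ +-identityʳ (w zero) ⟨
          w zero + 0#             ≈⟨ +-congˡ (sum-zero w₊≈0) ⟨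
          sum w                   ≈⟨ Σw≈0 ⟩
          0#                      ∎

-- Translates codimension one into numbers of points, which exceed the dimensions by one. The
-- integer differences compute once small values are split off.
consecutive : ∀ {d k k′} → d ≡ + k ℤ.- 1ℤ → d ℤ.- 1ℤ ≡ + k′ ℤ.- 1ℤ → k ≡ suc k′
consecutive {k = zero}        {zero}   refl ()
consecutive {k = zero}        {suc k′} refl ()
consecutive {k = suc zero}    {zero}   refl eq = refl
consecutive {k = suc zero}    {suc k′} refl ()
consecutive {k = suc (suc k)} {zero}   refl ()
consecutive {k = suc (suc k)} {suc k′} refl refl = refl

-- The polytope and its face x_e = 0.

module Facet {c ℓ₁ ℓ₂ ℓ₃} (𝔽 : OrderedField c ℓ₁ ℓ₂ ℓ₃) (G : Graph)
  (2ec : TwoEdgeConnected (whole G)) where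
  open OrderedField 𝔽 hiding (zero; refl; sym; trans)
  open OrderedField 𝔽 using () renaming (refl to ≈-refl; sym to ≈-sym; trans to ≈-trans)
  open OrderedFieldProperties 𝔽
  open CommSemigroup
    (CommutativeMonoid.commutativeSemigroup (CommutativeRing.+-commutativeMonoid commutativeRing))
    using (x∙yz≈y∙xz)
  open SemiringSum (CommutativeRing.semiring commutativeRing)
  open import Relation.Binary.Reasoning.Setoid (CommutativeRing.setoid commutativeRing)
  open Polyhedra 𝔽
  open Graph G
  open Subgraph
  open CutSpace G
  open TwoEdgeConnectedGraph 2ec

  χ-∈ : ∀ {k} {D : Subset k} {j} → j ∈ D → χ D j ≡ 1#
  χ-∈ j∈D rewrite []=⇒lookup j∈D = refl

  χ-∉ : ∀ {k} {D : Subset k} {j} → j ∉ D → χ D j ≡ 0#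
  χ-∉ {D = D} {j} j∉D with lookup D j in eq
  ... | true  = contradiction (lookup⇒[]= j D eq) j∉D
  ... | false = refl

  χ-cong : ∀ {k} {D : Subset k} {i j} → i ∈ D ⇔ j ∈ D → χ D i ≡ χ D j
  χ-cong {D = D} {i} {j} i⇔j with i ∈? D
  ... | yes i∈D = trans (χ-∈ i∈D) (sym (χ-∈ (Equivalence.to i⇔j i∈D)))
  ... | no  i∉D = trans (χ-∉ i∉D) (sym (χ-∉ (i∉D ∘ Equivalence.from i⇔j)))

  χ⁅e⁆·x≈xₑ : ∀ {k} (e : Fin k) x → χ ⁅ e ⁆ · x ≈ x e
  χ⁅e⁆·x≈xₑ e x = begin
    χ ⁅ e ⁆ · x        ≈⟨ sum-single e (λ j j≢e → ≈-trans
                           (*-congʳ (reflexive (χ-∉ (x≢y⇒x∉⁅y⁆ j≢e)))) (zeroˡ (x j))) ⟩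
    χ ⁅ e ⁆ e * x e    ≈⟨ *-congʳ (reflexive (χ-∈ (x∈⁅x⁆ e))) ⟩
    1# * x e           ≈⟨ *-identityˡ (x e) ⟩
    x e                ∎

  Vertex : Pred (Point m) ℓ₁
  Vertex x = ∃ λ (H : Subgraph G) → TwoEdgeConnected H × (∀ j → x j ≈ χ (ES H) j)

  -- The list is empty for the whole polytope and `e ∷ []` for the face.
  VertexOff : List (Fin m) → Pred (Point m) ℓ₁
  VertexOff L x = Vertex x × (∀ {l} → l ∈ˡ L → x l ≈ 0#)

  w*χ-nonneg : ∀ {k} {w} (D : Subset k) j → 0# ≤ w → 0# ≤ w * χ D j
  w*χ-nonneg {w = w} D j 0≤w with lookup D j
  ... | true  = ≤-respʳ-≈ (≈-sym (*-identityʳ w)) 0≤w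
  ... | false = ≤-respʳ-≈ (≈-sym (zeroʳ w)) (IsStrictPartialOrder.irrefl <-isStrictPartialOrder ≈-refl)

  coordinate-nonneg : ∀ {x} → TECSP G x → ∀ j → 0# ≤ x j
  coordinate-nonneg (k , w , p , vertex , 0≤w , _ , x≈) j =
    ≤-respʳ-≈ (≈-sym (x≈ j)) (sum-nonneg λ i → let H , _ , p≈ = vertex i in
      ≤-respʳ-≈ (*-congˡ (≈-sym (p≈ j))) (w*χ-nonneg (ES H) j (0≤w i)))

  parallel-coordinates : ∀ {f g} → f ~ g → ∀ {x} → TECSP G x → x f ≈ x g
  parallel-coordinates {f} {g} f~g = conv-coordinates {X = Vertex} λ { y (H , 2ecH , y≈) →
    ≈-trans (y≈ f) (≈-trans (reflexive (χ-cong {D = ES H}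
      (mk⇔ (~⇒⊆ {H} 2ecH f~g) (~⇒⊆ {H} 2ecH (~-sym f~g))))) (≈-sym (y≈ g))) }

  -- On the face x_e = 0 all the subgraphs of a convex combination with positive weight avoid e.
  face-coordinates : ∀ {e f g} →
    (∀ {H : Subgraph G} → TwoEdgeConnected H → e ∉ ES H → f ∈ ES H ⇔ g ∈ ES H) →
    ∀ {x} → TECSP G x → x e ≈ 0# → x f ≈ x g
  face-coordinates {e} {f} {g} f⇔g {x} (k , w , p , vertex , 0≤w , _ , x≈) xe≈0 = begin
    x f                ≈⟨ x≈ f ⟩
    combination w p f  ≈⟨ sum-cong-≋ same ⟩
    combination w p g  ≈⟨ x≈ g ⟨
    x g                ∎
    where
    H = λ i → proj₁ (vertex i)
    term : ∀ i j → w i * p i j ≈ w i * χ (ES (H i)) j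
    term i j = *-congˡ (proj₂ (proj₂ (vertex i)) j)
    terms-zero : ∀ i → w i * p i e ≈ 0#
    terms-zero = sum-nonneg-≈0 (λ i → ≤-respʳ-≈ (≈-sym (term i e)) (w*χ-nonneg (ES (H i)) e (0≤w i)))
      (≈-trans (≈-sym (x≈ e)) xe≈0)
    same : ∀ i → w i * p i f ≈ w i * p i g
    -- The split is on membership of `e`, which is decidable, and not on the weight; a subgraph
    -- through `e` must have weight zero.
    same i with e ∈? ES (H i)
    ... | no e∉H  = ≈-trans (term i f) (≈-trans
            (*-congˡ (reflexive (χ-cong {D = ES (H i)} (f⇔g {H i} (proj₁ (proj₂ (vertex i))) e∉H))))
            (≈-sym (term i g)))
    ... | yes e∈H = ≈-trans (vanish f) (≈-sym (vanish g))
      where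
      w≈0 : w i ≈ 0#
      w≈0 = begin
        w i                     ≈⟨ *-identityʳ (w i) ⟨
        w i * 1#                ≈⟨ *-congˡ (reflexive (χ-∈ e∈H)) ⟨
        w i * χ (ES (H i)) e    ≈⟨ term i e ⟨
        w i * p i e             ≈⟨ terms-zero i ⟩
        0#                      ∎
      vanish : ∀ j → w i * p i j ≈ 0#
      vanish j = ≈-trans (*-congʳ w≈0) (zeroˡ (p i j))

  -- Affinely independent points from components.

  empty : Subgraph G
  empty = record { VS = ⊥ ; ES = ⊥ ; closed = λ e∈⊥ → contradiction e∈⊥ ∉⊥ }

  empty-2ec : TwoEdgeConnected empty
  empty-2ec = (λ u∈⊥ → contradiction u∈⊥ ∉⊥) , λ { e (S , (u , u∈S) , (S⊆⊥ , _) , _) → ∉⊥ (S⊆⊥ u∈S) }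

  -- Each edge of `A` lies in exactly one component, the one labelled by its source.
  sum-components : ∀ A t → sum (λ v → χ (ES (component A v)) t) ≈ (if A t then 1# else 0#)
  sum-components A t = ≈-trans
    (sum-single (label A (src t)) λ v v≢ → reflexive (χ-∉ λ t∈ → v≢ (sym (proj₂ (∈-component-edge⁻ A t∈)))))
    (reflexive own)
    where
    own : χ (ES (component A (label A (src t)))) t ≡ (if A t then 1# else 0#)
    own with A t in eq
    ... | true  = χ-∈ (∈-component-edge A eq refl)
    ... | false = χ-∉ λ t∈ → contradiction (trans (sym (proj₁ (∈-component-edge⁻ A t∈))) eq) λ ()

  -- Deleting the class of `r i` besides those of `L` changes the sum of the component vectors by
  -- χ([r i]), which is the i-th unit vector in the coordinates `r`. The `Detached` hypotheses make
  -- all these components 2-edge-connected.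
  independent-points : ∀ L {k} (r : Fin k → Fin m) → (∀ i j → r i ~ r j → i ≡ j) →
    (∀ i → ¬ Any (r i ~_) L) → Detached L → (∀ i → Detached (r i ∷ L)) →
    ∃ λ (p : Vector (Point m) (suc k)) →
      (∀ i → conv (VertexOff L) (p i)) × AffinelyIndependent p
  independent-points L {k} r inj r∉L detached detached′ =
    perturbations {X = VertexOff L} r {χ (ES empty)}
      ((empty , empty-2ec , λ _ → ≈-refl) , λ {l} _ → reflexive (χ-∉ {D = ⊥} {l} ∉⊥)) P P∈X shift
    where
    removed : Fin k → Bool → List (Fin m)
    removed i true  = L
    removed i false = r i ∷ L
    P : Fin k → Bool → Fin n → Point m
    P i b v = χ (ES (component (avoiding (removed i b)) v))
    removed-detached : ∀ i b → Detached (removed i b)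
    removed-detached i true  = detached
    removed-detached i false = detached′ i
    L⊆removed : ∀ i b {l} → l ∈ˡ L → l ∈ˡ removed i b
    L⊆removed i true  l∈L = l∈L
    L⊆removed i false l∈L = there l∈L
    P∈X : ∀ i b v → VertexOff L (P i b v)
    P∈X i b v =
      (component A v , component-2ec A (avoiding-bridgeless (removed i b) (removed-detached i b)) v ,
        λ _ → ≈-refl) ,
      λ l∈L → reflexive (χ-∉ λ l∈ → contradiction
        (trans (sym (proj₁ (∈-component-edge⁻ A l∈)))
          (avoiding-no (removed i b) (lose (L⊆removed i b l∈L) ~-refl))) λ ())
      where A = avoiding (removed i b)
    indicator : ∀ {b c} → b ≡ c → (if b then 1# else 0#) ≈ (if c then 1# else 0#)
    indicator refl = ≈-refl
    shift : ∀ i l → sum (λ v → P i true v (r l)) ≈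
                    sum (λ v → P i false v (r l)) + (if does (l ≟ i) then 1# else 0#)
    shift i l = begin
      sum (λ v → P i true v (r l))
        ≈⟨ sum-components (avoiding L) (r l) ⟩
      (if avoiding L (r l) then 1# else 0#)
        ≈⟨ indicator (avoiding-yes L (r∉L l)) ⟩
      1#
        ≈⟨ by-cases (l ≟ i) ⟩
      (if avoiding (r i ∷ L) (r l) then 1# else 0#) + (if does (l ≟ i) then 1# else 0#)
        ≈⟨ +-congʳ (sum-components (avoiding (r i ∷ L)) (r l)) ⟨
      sum (λ v → P i false v (r l)) + (if does (l ≟ i) then 1# else 0#) ∎
      where
      by-cases : (l≟i : Dec (l ≡ i)) →
        1# ≈ (if avoiding (r i ∷ L) (r l) then 1# else 0#) + (if does l≟i then 1# else 0#)
      by-cases (yes refl) = ≈-sym (≈-trans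
        (+-congʳ (indicator (avoiding-no (r i ∷ L) (here ~-refl)))) (+-identityˡ 1#))
      by-cases (no l≢i)   = ≈-sym (≈-trans (+-congʳ (indicator (avoiding-yes (r i ∷ L) λ
        { (here rl~ri) → l≢i (inj l i rl~ri) ; (there rl~L) → r∉L l rl~L }))) (+-identityʳ 1#))

  -- The two implications.

  conv-⊆ : ∀ {k ℓ ℓ′} (X : Pred (Point k) ℓ) (Y : Pred (Point k) ℓ′) → (∀ {x} → X x → Y x) →
           ∀ {x} → conv X x → conv Y x
  conv-⊆ X Y X⊆Y (k , w , p , p∈X , rest) = k , w , p , X⊆Y ∘ p∈X , rest

  -- Given a 3-cut {e , f , g}, both x_e and x_f - x_g vanish on the face. Adding χ(G), where x_e is
  -- 1, and χ(H) for an `H` containing `f` but not `g` extends `k′` independent points of the face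
  -- to `k′ + 2`, one more than the polytope admits.
  facet⇒no-three-cut : ∀ {e} → DefinesFacet (TECSP G) (χ ⁅ e ⁆) 0# → ¬ ThreeCut e
  facet⇒no-three-cut {e} (_ , d , (k , d≡ , _ , maximal) , (k′ , d-1≡ , (q , q∈F , q-indep) , _)) cut
    with refl ← consecutive {d} {k} {k′} d≡ d-1≡
    with f , g , f≁g , f⇔g ← three-cut-pair cut
    with H , 2ecH , f∈H , g∉H ← separate f≁g = maximal p p∈P indep
    where
    p : Vector (Point m) (suc (suc k′))
    p = χ ⊤ ∷ᶠ (χ (ES H) ∷ᶠ q)
    p∈P : ∀ i → TECSP G (p i)
    p∈P zero          = ⊆-conv {X = Vertex} (whole G , 2ec , λ _ → ≈-refl)
    p∈P (suc zero)    = ⊆-conv {X = Vertex} (H , 2ecH , λ _ → ≈-refl)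
    p∈P (suc (suc i)) = proj₁ (q∈F i)
    qₑ≈0 : ∀ i → q i e ≈ 0#
    qₑ≈0 i = ≈-trans (≈-sym (χ⁅e⁆·x≈xₑ e (q i))) (proj₂ (q∈F i))
    indep : AffinelyIndependent p
    indep w Σw≈0 Σwp≈0 = λ
      { zero          → w₀≈0
      ; (suc zero)    → w₁≈0
      ; (suc (suc i)) → q-indep w₊ (rest Σw≈0 w₀≈0 w₁≈0)
          (λ j → rest (Σwp≈0 j) (≈-trans (*-congʳ w₀≈0) (zeroˡ _)) (≈-trans (*-congʳ w₁≈0) (zeroˡ _))) i }
      where
      w₀ = w zero
      w₁ = w (suc zero)
      w₊ = λ i → w (suc (suc i))
      rest : ∀ {a b s} → a + (b + s) ≈ 0# → a ≈ 0# → b ≈ 0# → s ≈ 0#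
      rest {a} {b} {s} eq a≈0 b≈0 = begin
        s               ≈⟨ +-identityˡ s ⟨
        0# + s          ≈⟨ +-identityˡ (0# + s) ⟨
        0# + (0# + s)   ≈⟨ +-cong a≈0 (+-congʳ b≈0) ⟨
        a + (b + s)     ≈⟨ eq ⟩
        0#              ∎
      w₀χ⊤ : ∀ j → w₀ * χ ⊤ j ≈ w₀
      w₀χ⊤ j = ≈-trans (*-congˡ (reflexive (χ-∈ (∈⊤ {x = j})))) (*-identityʳ w₀)
      -- Coordinates `f` and `g` agree on χ(G) and on the face, so their difference in the
      -- combination is `w₁`. This comes before `w₀`, as `H` may contain `e`.
      w₁≈0 : w₁ ≈ 0#
      w₁≈0 = begin
        w₁                                     ≈⟨ +-identityʳ w₁ ⟨
        w₁ + 0#                                ≈⟨ +-congˡ (Σwp≈0 g) ⟨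
        w₁ + combination w p g                 ≈⟨ +-congˡ (+-cong (w₀χ⊤ g) (+-congʳ
                                                    (≈-trans (*-congˡ (reflexive (χ-∉ g∉H))) (zeroʳ w₁)))) ⟩
        w₁ + (w₀ + (0# + combination w₊ q g))  ≈⟨ +-congˡ (+-congˡ (+-identityˡ _)) ⟩
        w₁ + (w₀ + combination w₊ q g)         ≈⟨ x∙yz≈y∙xz w₁ w₀ _ ⟩
        w₀ + (w₁ + combination w₊ q g)         ≈⟨ +-cong (w₀χ⊤ f) (+-cong
                                                    (≈-trans (*-congˡ (reflexive (χ-∈ f∈H))) (*-identityʳ w₁))
                                                    (sum-cong-≋ {k′} λ i → *-congˡ
                                                      (face-coordinates (λ {K} → f⇔g {K}) (proj₁ (q∈F i)) (qₑ≈0 i)))) ⟨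
        combination w p f                      ≈⟨ Σwp≈0 f ⟩
        0#                                     ∎
      w₀≈0 : w₀ ≈ 0#
      w₀≈0 = begin
        w₀                     ≈⟨ +-identityʳ w₀ ⟨
        w₀ + 0#                ≈⟨ +-cong (w₀χ⊤ e) (≈-trans (+-cong (≈-trans (*-congʳ w₁≈0) (zeroˡ _))
                                    (sum-zero λ i → ≈-trans (*-congˡ (qₑ≈0 i)) (zeroʳ (w₊ i)))) (+-identityˡ 0#)) ⟨
        combination w p e      ≈⟨ Σwp≈0 e ⟩
        0#                     ∎

  -- With `c` classes besides that of `e`, the polytope has dimension `c + 1` and the face dimension
  -- `c`. Components give the lower bounds; the upper bounds hold as coordinates are constant on
  -- classes and those in the class of `e` vanish on the face.
  no-three-cut⇒facet : ∀ {e} → ¬ ThreeCut e → DefinesFacet (TECSP G) (χ ⁅ e ⁆) 0#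
  no-three-cut⇒facet {e} no-cut with c , r , inj , r≁e , cover ← representatives e =
    (λ x x∈P → ≤-respʳ-≈ (≈-sym (χ⁅e⁆·x≈xₑ e x)) (coordinate-nonneg x∈P e)) ,
    + suc c , dim-polytope , dim-face
    where
    q : Fin (suc c) → Fin m
    q = e ∷ᶠ r
    q-inj : ∀ i j → q i ~ q j → i ≡ j
    q-inj zero    zero    _   = refl
    q-inj zero    (suc j) e~r = contradiction (~-sym e~r) (r≁e j)
    q-inj (suc i) zero    r~e = contradiction r~e (r≁e i)
    q-inj (suc i) (suc j) r~r = cong suc (inj i j r~r)

    dim-polytope : HasDim (TECSP G) (+ suc c)
    dim-polytope = suc (suc c) , refl ,
      (let p , p∈ , indep = independent-points [] q q-inj (λ _ ()) detached-[] (detached-[_] ∘ q)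
       in p , conv-⊆ (VertexOff []) Vertex proj₁ ∘ p∈ , indep) ,
      λ p p∈P → affinely-dependent p q λ t → inj₂ (case cover t of λ
        { (inj₁ t~e)       → zero , λ i → parallel-coordinates t~e (p∈P i)
        ; (inj₂ (l , t~r)) → suc l , λ i → parallel-coordinates t~r (p∈P i) })

    dim-face : HasDim (λ x → TECSP G x × χ ⁅ e ⁆ · x ≈ 0#) (+ suc c ℤ.- 1ℤ)
    dim-face = suc c , refl ,
      (let p , p∈ , indep = independent-points (e ∷ []) r inj (λ { i (here r~e) → r≁e i r~e })
                              detached-[ e ] (λ i → detached-pair no-cut (r≁e i))
       in p , (λ i → conv-⊆ (VertexOff (e ∷ [])) Vertex proj₁ (p∈ i) ,
                     ≈-trans (χ⁅e⁆·x≈xₑ e (p i)) (vanishes (p∈ i))) , indep) ,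
      λ p p∈F → affinely-dependent p r λ t → case cover t of λ
        { (inj₁ t~e)       → inj₁ λ i → ≈-trans (parallel-coordinates t~e (proj₁ (p∈F i)))
                               (≈-trans (≈-sym (χ⁅e⁆·x≈xₑ e (p i))) (proj₂ (p∈F i)))
        ; (inj₂ (l , t~r)) → inj₂ (l , λ i → parallel-coordinates t~r (proj₁ (p∈F i))) }
      where
      vanishes : ∀ {x} → conv (VertexOff (e ∷ [])) x → x e ≈ 0#
      vanishes (k , w , p , p∈ , _ , _ , x≈) = ≈-trans (x≈ e)
        (sum-zero λ i → ≈-trans (*-congˡ (proj₂ (p∈ i) (here refl))) (zeroʳ (w i)))

mainTheorem5 : ∀ {c ℓ₁ ℓ₂ ℓ₃} (𝔽 : OrderedField c ℓ₁ ℓ₂ ℓ₃) →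
    let open OrderedField 𝔽 using (0#)
        open Polyhedra 𝔽
    in
    (G : Graph) → TwoEdgeConnected (whole G) → (e : Fin (Graph.m G)) →
    -- χ ⁅ e ⁆ · x is the coordinate x_e
    DefinesFacet (TECSP G) (χ ⁅ e ⁆) 0# ⇔
      (¬ (∃[ D ] (IsCut (whole G) D × ∣ D ∣ ≡ 3 × e ∈ D)))
mainTheorem5 𝔽 G 2ec e = mk⇔ facet⇒no-three-cut no-three-cut⇒facet
  where open Facet 𝔽 G 2ec
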